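{- Let $i$ be a positive integer with $i\le\frac27\left(r+\frac52\right)$. Then there exists an injective map $\phi$ from the set of $(i-1)$-element subsets of $[r]$ to the set of $i$-element subsets of $[r]$ such that $\phi(T)$ dominates $T$ for every $(i-1)$-element subset $T$.
   Context: For $\pi=a_1\cdots a_{r+1}\in S_{r+1}$ the descent set is $\{j\in[r]:a_j>a_{j+1}\}$ and $D(T)$ is the set of permutations in $S_{r+1}$ with descent set $T$. The inversion set is $I(\pi)=\{(a_j,a_k):j<k,\ a_j>a_k\}$ and the weak Bruhat order is $\pi\le_w\pi'$ iff $I(\pi)\subseteq I(\pi')$. $S$ dominates $T$ if there is an injection $\psi:D(T)\to D(S)$ with $\pi\le_w\psi(\pi)$ for all $\pi\in D(T)$. -}

module Defs where

open import Data.Nat using (ℕ; suc)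
open import Data.Fin using (Fin; inject₁; _<_; _<?_) renaming (suc to Fsuc)
open import Data.Fin.Subset using (Subset; inside; outside; Side; ∣_∣)
open import Data.Vec using (Vec; lookup; tabulate)
open import Data.Product using (Σ; ∃; ∃-syntax; _×_; proj₁)
open import Relation.Nullary using (yes; no)
open import Relation.Binary.PropositionalEquality using (_≡_)

-- A permutation a₁⋯aₙ of [n] (values 0-based: Fin n) in one-line notation:
-- a vector of length n whose entries are pairwise distinct.
IsPerm : {n : ℕ} → Vec (Fin n) n → Set
IsPerm {n} v = ∀ (j k : Fin n) → lookup v j ≡ lookup v k → j ≡ k

-- Descent set of π ∈ S_{r+1}, as a subset of [r] (position j ∈ Fin r stands
-- for the descent index j+1, i.e. a_{j+1} > a_{j+2} in 1-based notation).
descentSide : {n : ℕ} → Fin n → Fin n → Side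
descentSide x y with y <? x
... | yes _ = inside
... | no  _ = outside

descentSet : {r : ℕ} → Vec (Fin (suc r)) (suc r) → Subset r
descentSet v = tabulate (λ j → descentSide (lookup v (inject₁ j)) (lookup v (Fsuc j)))

D : {r : ℕ} → Subset r → Set
D {r} T = Σ (Vec (Fin (suc r)) (suc r)) (λ v → IsPerm v × descentSet v ≡ T)

Inv : {n : ℕ} → Vec (Fin n) n → Fin n → Fin n → Set
Inv {n} v a b = ∃[ j ] ∃[ k ] (j < k × lookup v j ≡ a × lookup v k ≡ b × b < a)

_≤w_ : {n : ℕ} → Vec (Fin n) n → Vec (Fin n) n → Set
π ≤w π' = ∀ a b → Inv π a b → Inv π' a b

Dominates : {r : ℕ} → Subset r → Subset r → Set
Dominates {r} S T =
  Σ (D T → D S) λ ψ →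
    (∀ (π π' : D T) → proj₁ (ψ π) ≡ proj₁ (ψ π') → proj₁ π ≡ proj₁ π')
    × (∀ (π : D T) → proj₁ π ≤w proj₁ (ψ π))

KSubset : ℕ → ℕ → Set
KSubset r k = Σ (Subset r) (λ T → ∣ T ∣ ≡ k)

{-# OPTIONS --safe #-}

-- An ascent j of T that is not adjacent to a descent can always be added: transposing
-- the entries at j and j+1 embeds D(T) into D(T ∪ {j}). Such j alone are too few, but
-- two further kinds of ascents following a descent work too, by rearranging four or
-- six consecutive entries (`Window`). Scanning T from left to right with a bounded
-- credit shows that at least r − (5/2)|T| − 1/2 ascents can be added. For |T| = i − 1 and
-- 7i ≤ 2r + 5 this is at least i − 1/2, hence i by integrality. Every i-set arises from
-- at most i sets in this way, so Hall's theorem gives the injection φ.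
module Submission where

open import Defs
open import Data.Nat using (ℕ; zero; suc; _≤_; _<_; _*_; _+_; _∸_; _≤?_; z≤n; s≤s; s≤s⁻¹)
import Data.Nat.Properties as ℕ
open import Data.Nat.Solver using (module +-*-Solver)
open import Data.Bool.Properties using () renaming (_≟_ to _≟ᵇ_)
open import Data.Fin using (Fin; zero; suc; inject₁) renaming (_<_ to _≺_; _≤_ to _≼_; _<?_ to _≺?_)
import Data.Fin.Properties as Fin
open import Data.Fin.Subset using (Subset; Side; inside; outside; ∣_∣)
open import Data.List using (List; []; _∷_; _++_; map; length; concatMap; filter)
import Data.List.Properties as List
open import Data.List.Membership.Propositional using (_∈_; _∉_; find; lose)
open import Data.List.Membership.Propositional.Properties
  using (∈-map⁺; ∈-map⁻; ∈-++⁺ˡ; ∈-++⁺ʳ; ∈-++⁻; ∈-∃++; ∈-concatMap⁺; ∈-concatMap⁻; ∈-filter⁺;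
         ∈-filter⁻)
import Data.List.Membership.DecPropositional as DecMembership
open import Data.List.Relation.Binary.Disjoint.Propositional using (Disjoint)
open import Data.List.Relation.Binary.Permutation.Propositional
  using (_↭_; prep; ↭-refl; ↭-sym; ↭-trans; ↭-reflexive; ↭⇒↭ₛ)
open import Data.List.Relation.Binary.Permutation.Propositional.Properties
  using (shift; ∈-resp-↭; All-resp-↭; ↭-length; map⁺; ++⁺ˡ)
import Data.List.Relation.Binary.Permutation.Setoid.Properties as Permutationₛ
open import Data.List.Relation.Binary.Subset.Propositional using (_⊆_)
open import Data.List.Relation.Unary.All using (All; []; _∷_; all?)
import Data.List.Relation.Unary.All as All
import Data.List.Relation.Unary.All.Properties as All
open import Data.List.Relation.Unary.AllPairs using ([]; _∷_)
open import Data.List.Relation.Unary.Any using (here; there)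
open import Data.List.Relation.Unary.Unique.Propositional using (Unique)
import Data.List.Relation.Unary.Unique.Propositional.Properties as Unique
open import Data.Product using (Σ; ∃; ∃₂; _×_; _,_; proj₁; proj₂)
open import Data.Sum using (_⊎_; inj₁; inj₂)
open import Data.Vec using (Vec; []; _∷_; head; lookup; tabulate; _[_]≔_)
import Data.Vec.Properties as Vec
open import Data.Vec.Relation.Unary.All using ([]; _∷_) renaming (All to Allᵛ)
open import Data.Vec.Relation.Unary.AllPairs using ([]; _∷_)
open import Data.Vec.Relation.Unary.Unique.Propositional using () renaming (Unique to Distinct)
import Data.Vec.Relation.Unary.Unique.Propositional.Properties as Distinct
open import Function using (_∘_)
open import Relation.Binary using (DecidableEquality)
open import Relation.Binary.Definitions using (tri<; tri≈; tri>)
open import Relation.Binary.PropositionalEquality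
  using (_≡_; _≢_; refl; sym; trans; cong; subst; setoid)
open import Relation.Nullary using (yes; no; contradiction)
open import Relation.Nullary.Decidable using (True; toWitness; from-yes)

private variable
  N n r : ℕ
  w x y z a b c : Fin N
  u v t : Vec (Fin N) n
  p : Side
  S T Q : Subset r

-- Dominations obtained by rearranging a window

-- For distinct entries, an inductive form of `descentSet v ≡ T`: matching on it yields the
-- comparisons of neighbouring entries. `N` is independent of the length, so that tails of a
-- permutation are covered too.
data Descents {N} : Vec (Fin N) (suc r) → Subset r → Set where
  [-]  : Descents (x ∷ []) []
  up   : x ≺ y → Descents (y ∷ v) T → Descents (x ∷ y ∷ v) (outside ∷ T)
  down : y ≺ x → Descents (y ∷ v) T → Descents (x ∷ y ∷ v) (inside ∷ T)

descentSequence : Vec (Fin N) (suc r) → Subset r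
descentSequence v = tabulate (λ j → descentSide (lookup v (inject₁ j)) (lookup v (suc j)))

descents : (v : Vec (Fin N) (suc r)) → Distinct v → Descents v (descentSequence v)
descents (x ∷ [])    _ = [-]
descents (x ∷ y ∷ v) ((x≢y ∷ _) ∷ d) with y ≺? x
... | yes y<x = down y<x (descents (y ∷ v) d)
... | no  y≮x = up (Fin.≤∧≢⇒< (ℕ.≮⇒≥ y≮x) x≢y) (descents (y ∷ v) d)

descents⇒≡ : Descents v T → descentSequence v ≡ T
descents⇒≡ [-] = refl
descents⇒≡ (up {x = x} {y = y} x<y d) with y ≺? x
... | yes y<x = contradiction y<x (Fin.<-asym x<y)
... | no  _   = cong (outside ∷_) (descents⇒≡ d)
descents⇒≡ (down {y = y} {x = x} y<x d) with y ≺? x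
... | yes _   = cong (inside ∷_) (descents⇒≡ d)
... | no  y≮x = contradiction y<x y≮x

-- Weak order, generated by transposing adjacent ascending entries.
infix 4 _⊑_

data _⊑_ {N} : Vec (Fin N) n → Vec (Fin N) n → Set where
  swap   : x ≺ y → x ∷ y ∷ v ⊑ y ∷ x ∷ v
  prep   : u ⊑ v → x ∷ u ⊑ x ∷ v
  _then_ : u ⊑ v → v ⊑ t → u ⊑ t

infixr 5 _then_

⊑-All : ∀ {P : Fin N → Set} → u ⊑ v → Allᵛ P u → Allᵛ P v
⊑-All (swap _)   (px ∷ py ∷ ps) = py ∷ px ∷ ps
⊑-All (prep l)   (px ∷ ps)      = px ∷ ⊑-All l ps
⊑-All (l then m) ps             = ⊑-All m (⊑-All l ps)

⊑-Distinct : u ⊑ v → Distinct u → Distinct v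
⊑-Distinct (swap _)   ((x≢y ∷ x≢v) ∷ y≢v ∷ d) = ((x≢y ∘ sym) ∷ y≢v) ∷ x≢v ∷ d
⊑-Distinct (prep l)   (x≢u ∷ d)               = ⊑-All l x≢u ∷ ⊑-Distinct l d
⊑-Distinct (l then m) d                       = ⊑-Distinct m (⊑-Distinct l d)

⊑-lookup : u ⊑ v → ∀ k → ∃ λ k′ → lookup v k′ ≡ lookup u k
⊑-lookup (swap _)   zero          = suc zero , refl
⊑-lookup (swap _)   (suc zero)    = zero , refl
⊑-lookup (swap _)   (suc (suc k)) = suc (suc k) , refl
⊑-lookup (prep l)   zero          = zero , refl
⊑-lookup (prep l)   (suc k)       = let k′ , eq = ⊑-lookup l k in suc k′ , eq
⊑-lookup (l then m) k             =
  let k′ , eq = ⊑-lookup l k ; k″ , eq′ = ⊑-lookup m k′ in k″ , trans eq′ eq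

-- `Inv` with the number of values freed from the length, which allows induction on tails.
Inverted : Vec (Fin N) n → Fin N → Fin N → Set
Inverted v a b = ∃ λ j → ∃ λ k → j ≺ k × lookup v j ≡ a × lookup v k ≡ b × b ≺ a

-- A swap reverses only the pair `x`, `y`, which was ascending and hence not inverted; every other
-- pair keeps its order.
⊑-Inverted : u ⊑ v → Inverted u a b → Inverted v a b
⊑-Inverted (swap x<y) (zero , suc zero , _ , refl , refl , y<x) = contradiction y<x (Fin.<-asym x<y)
⊑-Inverted (swap _) (zero , suc (suc k) , _ , p) = suc zero , suc (suc k) , s≤s (s≤s z≤n) , p
⊑-Inverted (swap _) (suc zero , suc (suc k) , _ , p) = zero , suc (suc k) , s≤s z≤n , p
⊑-Inverted (swap _) (suc zero , suc zero , s≤s () , _)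
⊑-Inverted (swap _) (suc (suc j) , suc zero , s≤s () , _)
⊑-Inverted (swap _) (suc (suc j) , suc (suc k) , p) = suc (suc j) , suc (suc k) , p
⊑-Inverted (prep l) (zero , suc k , _ , eq , eq′ , b<a) =
  let k′ , eq″ = ⊑-lookup l k in zero , suc k′ , s≤s z≤n , eq , trans eq″ eq′ , b<a
⊑-Inverted (prep l) (suc j , suc k , s≤s j<k , p) =
  let j′ , k′ , j′<k′ , p′ = ⊑-Inverted l (j , k , j<k , p) in suc j′ , suc k′ , s≤s j′<k′ , p′
⊑-Inverted (l then m) i = ⊑-Inverted m (⊑-Inverted l i)

-- What may follow a window: an ascent or the end of the permutation.
data Calm : Subset r → Set where
  []  : Calm []
  up∷ : Calm (outside ∷ Q)

-- Some rules lower the last entry of their window. An ascent behind the window survives this, a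
-- descent might not; hence the condition `Calm`.
lower-head : y ≼ x → Calm Q → Descents (x ∷ v) Q → Descents (y ∷ v) Q
lower-head y≤x []  [-]        = [-]
lower-head y≤x up∷ (up x<z d) = up (ℕ.≤-<-trans y≤x x<z) d

-- Descent patterns of a window before and after; what precedes the window must likewise
-- be an ascent or the beginning.
data Window : Subset r → Subset r → Set where
  two  : Calm Q → Window (outside ∷ Q) (inside ∷ Q)
  four : Calm Q → Window (inside ∷ outside ∷ outside ∷ Q) (inside ∷ inside ∷ outside ∷ Q)
  six  : Calm Q → Window (outside ∷ inside ∷ outside ∷ outside ∷ inside ∷ Q)
                         (outside ∷ inside ∷ inside ∷ outside ∷ inside ∷ Q)

-- The hypotheses on the entries are those which tell the images of different rules apart.
data Move {N} : Window T S → Vec (Fin N) (suc r) → Vec (Fin N) (suc r) → Set where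
  two   : {q : Calm Q} → Move (two q) (x ∷ y ∷ v) (y ∷ x ∷ v)
  four₁ : {q : Calm Q} → x ≺ b → b ≺ c → Move (four q) (x ∷ a ∷ b ∷ c ∷ v) (c ∷ x ∷ a ∷ b ∷ v)
  four₂ : {q : Calm Q} → x ≺ c → b ≺ c → Move (four q) (x ∷ a ∷ b ∷ c ∷ v) (x ∷ b ∷ a ∷ c ∷ v)
  four₃ : {q : Calm Q} → b ≺ c → Move (four q) (x ∷ a ∷ b ∷ c ∷ v) (x ∷ c ∷ a ∷ b ∷ v)
  six₁  : {q : Calm Q} → w ≺ x → y ≺ x → x ≺ b → b ≺ c →
          Move (six q) (w ∷ x ∷ a ∷ b ∷ c ∷ y ∷ v) (w ∷ c ∷ x ∷ a ∷ b ∷ y ∷ v)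
  six₂  : {q : Calm Q} → a ≺ x → x ≺ y → x ≺ b → y ≺ c →
          Move (six q) (w ∷ x ∷ a ∷ b ∷ c ∷ y ∷ v) (b ∷ c ∷ x ∷ w ∷ y ∷ a ∷ v)
  six₃  : {q : Calm Q} → b ≺ c → Move (six q) (w ∷ x ∷ a ∷ b ∷ c ∷ y ∷ v) (w ∷ x ∷ c ∷ a ∷ b ∷ y ∷ v)
  six₄  : {q : Calm Q} → x ≺ c ⊎ b ≺ y → b ≺ c →
          Move (six q) (w ∷ x ∷ a ∷ b ∷ c ∷ y ∷ v) (w ∷ x ∷ b ∷ a ∷ c ∷ y ∷ v)

-- A single rule is a fixed rearrangement and can be undone. For two different rules, the
-- hypotheses, read at the same places of the common image, contradict each other.
move-injective : {W : Window T S} → Move W u t → Move W v t → u ≡ v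
move-injective two two = refl
move-injective (four₁ _ _) (four₁ _ _) = refl
move-injective (four₁ _ b<c) (four₂ c<b _) = contradiction b<c (Fin.<-asym c<b)
move-injective (four₁ x<b _) (four₃ b<x) = contradiction x<b (Fin.<-asym b<x)
move-injective (four₂ c<b _) (four₁ _ b<c) = contradiction b<c (Fin.<-asym c<b)
move-injective (four₂ _ _) (four₂ _ _) = refl
move-injective (four₂ _ b<c) (four₃ c<b) = contradiction b<c (Fin.<-asym c<b)
move-injective (four₃ b<x) (four₁ x<b _) = contradiction x<b (Fin.<-asym b<x)
move-injective (four₃ c<b) (four₂ _ b<c) = contradiction b<c (Fin.<-asym c<b)
move-injective (four₃ _) (four₃ _) = refl
move-injective (six₁ _ _ _ _) (six₁ _ _ _ _) = refl
move-injective (six₁ w<x _ _ _) (six₂ _ _ x<w _) = contradiction w<x (Fin.<-asym x<w)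
move-injective (six₁ _ _ x<b _) (six₃ b<x) = contradiction x<b (Fin.<-asym b<x)
move-injective (six₁ _ _ _ b<c) (six₄ (inj₁ c<b) _) = contradiction b<c (Fin.<-asym c<b)
move-injective (six₁ _ y<x _ _) (six₄ (inj₂ x<y) _) = contradiction y<x (Fin.<-asym x<y)
move-injective (six₂ _ _ x<b _) (six₁ b<x _ _ _) = contradiction x<b (Fin.<-asym b<x)
move-injective (six₂ _ _ _ _) (six₂ _ _ _ _) = refl
move-injective (six₂ _ x<y _ _) (six₃ y<x) = contradiction x<y (Fin.<-asym y<x)
move-injective (six₂ _ _ _ y<c) (six₄ (inj₁ c<y) _) = contradiction y<c (Fin.<-asym c<y)
move-injective (six₂ a<x _ _ _) (six₄ (inj₂ x<a) _) = contradiction a<x (Fin.<-asym x<a)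
move-injective (six₃ b<x) (six₁ _ _ x<b _) = contradiction x<b (Fin.<-asym b<x)
move-injective (six₃ y<x) (six₂ _ x<y _ _) = contradiction x<y (Fin.<-asym y<x)
move-injective (six₃ _) (six₃ _) = refl
move-injective (six₃ b<c) (six₄ _ c<b) = contradiction b<c (Fin.<-asym c<b)
move-injective (six₄ (inj₁ c<b) _) (six₁ _ _ _ b<c) = contradiction b<c (Fin.<-asym c<b)
move-injective (six₄ (inj₂ x<y) _) (six₁ _ y<x _ _) = contradiction y<x (Fin.<-asym x<y)
move-injective (six₄ (inj₁ c<y) _) (six₂ _ _ _ y<c) = contradiction y<c (Fin.<-asym c<y)
move-injective (six₄ (inj₂ x<a) _) (six₂ a<x _ _ _) = contradiction a<x (Fin.<-asym x<a)
move-injective (six₄ _ c<b) (six₃ b<c) = contradiction b<c (Fin.<-asym c<b)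
move-injective (six₄ _ _) (six₄ _ _) = refl

compare : x ≢ y → x ≺ y ⊎ y ≺ x
compare {x = x} {y} x≢y with Fin.<-cmp x y
... | tri< x<y _ _ = inj₁ x<y
... | tri≈ _ x≡y _ = contradiction x≡y x≢y
... | tri> _ _ y<x = inj₂ y<x

infixr 5 _⟫_

_⟫_ : {x y z : Fin N} → x ≺ y → y ≺ z → x ≺ z
_⟫_ = Fin.<-trans

-- In `four` the rule depends on where `x` falls relative to `b` and `c`, where `b ≺ c`; in `six`
-- the entry `y` matters as well. The head never decreases, so an ascent in front of the window
-- survives.
move : (W : Window T S) (u : Vec (Fin N) (suc r)) → Distinct u → Descents u T →
       ∃ λ v → Move W u v × u ⊑ v × Descents v S × head u ≼ head v
move (two q) (x ∷ y ∷ v) _ (up x<y d) =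
  _ , two , swap x<y , down x<y (lower-head (ℕ.<⇒≤ x<y) q d) , ℕ.<⇒≤ x<y
move (four q) (x ∷ a ∷ b ∷ c ∷ v) ((_ ∷ x≢b ∷ x≢c ∷ _) ∷ _) (down a<x (up a<b (up b<c d)))
  with compare x≢b | compare x≢c
... | inj₁ x<b | _ =
  _ , four₁ x<b b<c
    , (prep (prep (swap b<c)) then prep (swap (a<b ⟫ b<c)) then swap (x<b ⟫ b<c))
    , down (x<b ⟫ b<c) (down a<x (up a<b (lower-head (ℕ.<⇒≤ b<c) q d)))
    , ℕ.<⇒≤ (x<b ⟫ b<c)
... | inj₂ b<x | inj₁ x<c =
  _ , four₂ x<c b<c , prep (swap a<b) , down b<x (down a<b (up (a<b ⟫ b<c) d)) , Fin.≤-refl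
... | inj₂ b<x | inj₂ c<x =
  _ , four₃ b<c , (prep (prep (swap b<c)) then prep (swap (a<b ⟫ b<c)))
    , down c<x (down (a<b ⟫ b<c) (up a<b (lower-head (ℕ.<⇒≤ b<c) q d))) , Fin.≤-refl
move (six q) (w ∷ x ∷ a ∷ b ∷ c ∷ y ∷ v)
  (_ ∷ (_ ∷ x≢b ∷ x≢c ∷ x≢y ∷ _) ∷ _ ∷ (_ ∷ b≢y ∷ _) ∷ _)
  (up w<x (down a<x (up a<b (up b<c (down y<c d)))))
  with compare x≢b | compare x≢y | compare x≢c | compare b≢y
... | inj₁ x<b | inj₂ y<x | _ | _ =
  _ , six₁ w<x y<x x<b b<c
    , prep (prep (prep (swap b<c)) then prep (swap (a<b ⟫ b<c)) then swap (x<b ⟫ b<c))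
    , up (w<x ⟫ x<b ⟫ b<c) (down (x<b ⟫ b<c) (down a<x (up a<b (down (y<x ⟫ x<b) d))))
    , Fin.≤-refl
... | inj₁ x<b | inj₁ x<y | _ | _ =
  _ , six₂ a<x x<y x<b y<c
    -- First `b` and then `c` travel leftwards past `a`, `x` and `w`; then `w`, `x` and `a`, `y` are
    -- exchanged.
    , (prep (prep (swap a<b)) then prep (swap x<b) then swap (w<x ⟫ x<b)
       then prep (prep (prep (swap (a<b ⟫ b<c))) then prep (swap (x<b ⟫ b<c))
                  then swap (w<x ⟫ x<b ⟫ b<c))
       then prep (prep (swap w<x then prep (prep (swap (a<x ⟫ x<y))))))
    , up b<c (down (x<b ⟫ b<c) (down w<x (up (w<x ⟫ x<y) (down (a<x ⟫ x<y)
        (lower-head (ℕ.<⇒≤ (a<x ⟫ x<y)) q d)))))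
    , ℕ.<⇒≤ (w<x ⟫ x<b)
... | inj₂ b<x | _ | inj₂ c<x | inj₂ y<b =
  _ , six₃ b<c , prep (prep (prep (swap b<c)) then prep (swap (a<b ⟫ b<c)))
    , up w<x (down c<x (down (a<b ⟫ b<c) (up a<b (down y<b d)))) , Fin.≤-refl
... | inj₂ b<x | _ | inj₁ x<c | _ =
  _ , six₄ (inj₁ x<c) b<c , prep (prep (swap a<b))
    , up w<x (down b<x (down a<b (up (a<b ⟫ b<c) (down y<c d)))) , Fin.≤-refl
... | inj₂ b<x | _ | inj₂ _ | inj₁ b<y =
  _ , six₄ (inj₂ b<y) b<c , prep (prep (swap a<b))
    , up w<x (down b<x (down a<b (up (a<b ⟫ b<c) (down y<c d)))) , Fin.≤-refl

-- A window at some position; the side says whether T is preceded by a descent, the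
-- beginning of the permutation counting as an ascent.
data Step : Side → Subset r → Subset r → Set where
  here  : Window T S → Step outside T S
  there : ∀ {o} → Step p T S → Step o (p ∷ T) (p ∷ S)

data Moves {N} : Step p T S → Vec (Fin N) (suc r) → Vec (Fin N) (suc r) → Set where
  here  : {W : Window T S} → Move W u v → Moves (here W) u v
  there : ∀ {o} {s : Step p T S} → Moves s u v → Moves (there {o = o} s) (x ∷ u) (x ∷ v)

moves-injective : {s : Step p T S} → Moves s u t → Moves s v t → u ≡ v
moves-injective (here m)  (here m′)  = move-injective m m′
moves-injective (there m) (there m′) = cong (_ ∷_) (moves-injective m m′)

-- The change of head that a preceding ascent or descent tolerates. Equality after a descent is
-- attainable because no window begins there.
HeadCompatible : Side → Vec (Fin N) (suc n) → Vec (Fin N) (suc n) → Set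
HeadCompatible outside u v = head u ≼ head v
HeadCompatible inside  u v = head u ≡ head v

headCompatible-∷ : ∀ p → HeadCompatible p (x ∷ u) (x ∷ v)
headCompatible-∷ outside = Fin.≤-refl
headCompatible-∷ inside  = refl

descents-∷ : Descents (x ∷ u) (p ∷ T) → HeadCompatible p u v → Descents v S →
             Descents (x ∷ v) (p ∷ S)
descents-∷ {v = _ ∷ _} (up x<y _) le d = up (ℕ.<-≤-trans x<y le) d
descents-∷ {v = _ ∷ _} (down y<x _) refl d = down y<x d

descents-tail : Descents (x ∷ u) (p ∷ T) → Descents u T
descents-tail (up _ d)   = d
descents-tail (down _ d) = d

moves : (s : Step p T S) (u : Vec (Fin N) (suc r)) → Distinct u → Descents u T →
        ∃ λ v → Moves s u v × u ⊑ v × Descents v S × HeadCompatible p u v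
moves (here W) u ! d = let v , m , l , d′ , h = move W u ! d in v , here m , l , d′ , h
moves {p = p} (there s) (x ∷ u) (_ ∷ !) d =
  let v , m , l , d′ , h = moves s u ! (descents-tail d)
  in x ∷ v , there m , prep l , descents-∷ d h d′ , headCompatible-∷ p

isPerm⇒distinct : {v : Vec (Fin n) n} → IsPerm v → Distinct v
isPerm⇒distinct {v = v} inj =
  subst Distinct (Vec.tabulate∘lookup v) (Distinct.tabulate⁺ λ {j} {k} → inj j k)

step⇒dominates : Step p T S → Dominates S T
step⇒dominates {T = T} {S} s = ψ , ψ-injective , ψ-increasing
  where
  image : (π : D T) → _
  image (v , inj , eq) =
    moves s v (isPerm⇒distinct inj) (subst (Descents v) eq (descents v (isPerm⇒distinct inj)))

  ψ : D T → D S
  ψ π@(v , inj , eq) =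
    let v′ , _ , l , d , _ = image π
    in v′ , Distinct.lookup-injective (⊑-Distinct l (isPerm⇒distinct inj)) , descents⇒≡ d

  ψ-injective : ∀ π π′ → proj₁ (ψ π) ≡ proj₁ (ψ π′) → proj₁ π ≡ proj₁ π′
  ψ-injective π π′ eq =
    moves-injective (proj₁ (proj₂ (image π)))
      (subst (Moves s _) (sym eq) (proj₁ (proj₂ (image π′))))

  ψ-increasing : ∀ π → proj₁ π ≤w proj₁ (ψ π)
  ψ-increasing π a b = ⊑-Inverted (proj₁ (proj₂ (proj₂ (image π))))

-- Counting the positions that can be added

-- What is remembered of the positions read so far; the beginning counts as an ascent,
-- but not as one that could lie inside a window (so the initial state is `afterUp`).
data State : Set where
  afterUp afterUpUp afterDown afterUpDown afterDownDown : State

-- An ascent leads to `afterUp` if a descent precedes it, and to `afterUpUp` otherwise. Only an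
-- ascent of the second kind can open a window `six`, so a descent following it gets its own state
-- `afterUpDown`.
next : State → Side → State
next afterUp       outside = afterUpUp
next afterUp       inside  = afterDown
next afterUpUp     outside = afterUpUp
next afterUpUp     inside  = afterUpDown
next afterDown     outside = afterUp
next afterUpDown   outside = afterUp
next afterDownDown outside = afterUp
next _             inside  = afterDownDown

calm : Subset r → Side
calm []            = inside
calm (outside ∷ _) = inside
calm (inside ∷ _)  = outside

-- Marks the ascents that some window adds: `two` in the first two rows, `four` in the next three,
-- `six` in the sixth. The entries still to come are inspected because a window extends past the
-- added position and must be followed by an ascent or the end.
slot : State → Side → Subset r → Side
slot afterUp     outside Q                      = calm Q
slot afterUpUp   outside Q                      = calm Q
slot afterDown   outside (outside ∷ Q)          = calm Q
slot afterUpDown outside (outside ∷ [])         = inside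
slot afterUpDown outside (outside ∷ outside ∷ Q) = inside
slot afterUpDown outside (outside ∷ inside ∷ Q) = calm Q
slot _           _       _                      = outside

slots : State → Subset r → Subset r
slots s []      = []
slots s (b ∷ T) = slot s b T ∷ slots (next s b) T

-- The last entries read are put back, since a window may begin there.
StepAfter : State → Subset r → Subset r → Set
StepAfter afterUp       T S = Step outside T S
StepAfter afterUpUp     T S = Step outside (outside ∷ T) (outside ∷ S)
StepAfter afterDown     T S = Step outside (inside ∷ T) (inside ∷ S)
StepAfter afterUpDown   T S = Step outside (outside ∷ inside ∷ T) (outside ∷ inside ∷ S)
StepAfter afterDownDown T S = Step inside T S

stepAfter-∷ : ∀ s b → StepAfter (next s b) T S → StepAfter s (b ∷ T) (b ∷ S)
stepAfter-∷ afterUp       outside h = h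
stepAfter-∷ afterUp       inside  h = h
stepAfter-∷ afterUpUp     outside h = there h
stepAfter-∷ afterUpUp     inside  h = h
stepAfter-∷ afterDown     outside h = there (there h)
stepAfter-∷ afterDown     inside  h = there (there h)
stepAfter-∷ afterUpDown   outside h = there (there (there h))
stepAfter-∷ afterUpDown   inside  h = there (there (there h))
stepAfter-∷ afterDownDown outside h = there h
stepAfter-∷ afterDownDown inside  h = there h

calm⇒Calm : (Q : Subset r) → calm Q ≡ inside → Calm Q
calm⇒Calm []            _ = []
calm⇒Calm (outside ∷ _) _ = up∷

slot-step : ∀ s b (Q : Subset r) → slot s b Q ≡ inside →
            b ≡ outside × StepAfter s (outside ∷ Q) (inside ∷ Q)
slot-step afterUp     outside Q                       e = refl , here (two (calm⇒Calm Q e))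
slot-step afterUpUp   outside Q                       e = refl , there (here (two (calm⇒Calm Q e)))
slot-step afterDown   outside (outside ∷ Q)           e = refl , here (four (calm⇒Calm Q e))
slot-step afterUpDown outside (outside ∷ [])          e = refl , there (here (four []))
slot-step afterUpDown outside (outside ∷ outside ∷ Q) e = refl , there (here (four up∷))
slot-step afterUpDown outside (outside ∷ inside ∷ Q)  e = refl , here (six (calm⇒Calm Q e))

slots-step : ∀ s (T : Subset r) j → lookup (slots s T) j ≡ inside →
             lookup T j ≡ outside × StepAfter s T (T [ j ]≔ inside)
slots-step s (b ∷ T) zero e with refl , h ← slot-step s b T e = refl , h
slots-step s (b ∷ T) (suc j) e =
  let e′ , h = slots-step (next s b) T j e in e′ , stepAfter-∷ s b h

-- The least potential for which every case of `slots-bound` goes through.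
credit : State → ℕ
credit afterUp       = 1
credit afterUpUp     = 1
credit afterDown     = 3
credit afterUpDown   = 2
credit afterDownDown = 3

-- Doubled to stay in the natural numbers. For `afterUp` it says that at least r - (5/2)|T| - 1/2
-- positions can be added.
Bound : State → Subset r → Set
Bound {r} s T = 2 * r ≤ 2 * ∣ slots s T ∣ + (5 * ∣ T ∣ + credit s)

-- n positions are read, of which g can be added and d are descents.
advance : ∀ s s′ (T : Subset r) n g d {_ : True (2 * n + credit s′ ≤? 2 * g + (5 * d + credit s))} →
          Bound s′ T → 2 * (n + r) ≤ 2 * (g + ∣ slots s′ T ∣) + (5 * (d + ∣ T ∣) + credit s)
advance {r} s s′ T n g d {affordable} bound = begin
  2 * (n + r)
    ≡⟨ ℕ.*-distribˡ-+ 2 n r ⟩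
  2 * n + 2 * r
    ≤⟨ ℕ.+-monoʳ-≤ (2 * n) bound ⟩
  2 * n + (2 * m + (5 * e + credit s′))
    ≡⟨ solve 4 (λ n m e k → con 2 :* n :+ (con 2 :* m :+ (con 5 :* e :+ k))
                         := con 2 :* n :+ k :+ (con 2 :* m :+ con 5 :* e)) refl n m e (credit s′) ⟩
  2 * n + credit s′ + (2 * m + 5 * e)
    ≤⟨ ℕ.+-monoˡ-≤ _ (toWitness affordable) ⟩
  2 * g + (5 * d + credit s) + (2 * m + 5 * e)
    ≡⟨ solve 5 (λ g d k m e → con 2 :* g :+ (con 5 :* d :+ k) :+ (con 2 :* m :+ con 5 :* e)
                           := con 2 :* (g :+ m) :+ (con 5 :* (d :+ e) :+ k)) refl g d (credit s) m e ⟩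
  2 * (g + m) + (5 * (d + e) + credit s)
    ∎
  where
  open ℕ.≤-Reasoning
  open +-*-Solver
  m = ∣ slots s′ T ∣
  e = ∣ T ∣

-- An account is kept: an ascent that can be added is free, any other ascent costs 2, a descent
-- earns 3, and `credit s` is the balance required in state `s`. Each case reads just far enough for
-- the look-ahead of `slot` to be settled; words that end early are evaluated.
slots-bound : ∀ s (T : Subset r) → Bound s T
slots-bound s             [] = z≤n
slots-bound afterUp       (outside ∷ []) = from-yes (2 ≤? 3)
slots-bound afterUp       (outside ∷ outside ∷ T) =
  advance afterUp afterUpUp (outside ∷ T) 1 1 0 (slots-bound afterUpUp (outside ∷ T))
slots-bound afterUp       (outside ∷ inside ∷ T) =
  advance afterUp afterUpDown T 2 0 1 (slots-bound afterUpDown T)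
slots-bound afterUp       (inside ∷ T) =
  advance afterUp afterDown T 1 0 1 (slots-bound afterDown T)
slots-bound afterUpUp     (outside ∷ []) = from-yes (2 ≤? 3)
slots-bound afterUpUp     (outside ∷ outside ∷ T) =
  advance afterUpUp afterUpUp (outside ∷ T) 1 1 0 (slots-bound afterUpUp (outside ∷ T))
slots-bound afterUpUp     (outside ∷ inside ∷ T) =
  advance afterUpUp afterUpDown T 2 0 1 (slots-bound afterUpDown T)
slots-bound afterUpUp     (inside ∷ T) =
  advance afterUpUp afterUpDown T 1 0 1 (slots-bound afterUpDown T)
slots-bound afterDown     (outside ∷ []) = from-yes (2 ≤? 3)
slots-bound afterDown     (outside ∷ inside ∷ T) =
  advance afterDown afterDown T 2 0 1 (slots-bound afterDown T)
slots-bound afterDown     (outside ∷ outside ∷ []) = from-yes (4 ≤? 7)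
slots-bound afterDown     (outside ∷ outside ∷ outside ∷ T) =
  advance afterDown afterUp (outside ∷ outside ∷ T) 1 1 0 (slots-bound afterUp (outside ∷ outside ∷ T))
slots-bound afterDown     (outside ∷ outside ∷ inside ∷ T) =
  advance afterDown afterUpDown T 3 0 1 (slots-bound afterUpDown T)
slots-bound afterDown     (inside ∷ T) =
  advance afterDown afterDownDown T 1 0 1 (slots-bound afterDownDown T)
slots-bound afterUpDown   (outside ∷ []) = from-yes (2 ≤? 2)
slots-bound afterUpDown   (outside ∷ inside ∷ T) =
  advance afterUpDown afterDown T 2 0 1 (slots-bound afterDown T)
slots-bound afterUpDown   (outside ∷ outside ∷ []) = from-yes (4 ≤? 6)
slots-bound afterUpDown   (outside ∷ outside ∷ outside ∷ T) =
  advance afterUpDown afterUp (outside ∷ outside ∷ T) 1 1 0 (slots-bound afterUp (outside ∷ outside ∷ T))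
slots-bound afterUpDown   (outside ∷ outside ∷ inside ∷ []) = from-yes (6 ≤? 9)
-- Here window `six` is indispensable for the account: without its one addition the required 6 + 2
-- would exceed the available 5 + 2, and this case returns to its own state.
slots-bound afterUpDown   (outside ∷ outside ∷ inside ∷ outside ∷ T) =
  advance afterUpDown afterUpDown (outside ∷ T) 3 1 1 (slots-bound afterUpDown (outside ∷ T))
slots-bound afterUpDown   (outside ∷ outside ∷ inside ∷ inside ∷ T) =
  advance afterUpDown afterDownDown T 4 0 2 (slots-bound afterDownDown T)
slots-bound afterUpDown   (inside ∷ T) =
  advance afterUpDown afterDownDown T 1 0 1 (slots-bound afterDownDown T)
slots-bound afterDownDown (outside ∷ T) =
  advance afterDownDown afterUp T 1 0 0 (slots-bound afterUp T)
slots-bound afterDownDown (inside ∷ T) =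
  advance afterDownDown afterDownDown T 1 0 1 (slots-bound afterDownDown T)

-- Hall's theorem

unique-resp-↭ : ∀ {A : Set} {xs ys : List A} → xs ↭ ys → Unique xs → Unique ys
unique-resp-↭ p = Permutationₛ.Unique-resp-↭ (setoid _) (↭⇒↭ₛ p)

unique-∷ : ∀ {A : Set} {x : A} {xs} → x ∉ xs → Unique xs → Unique (x ∷ xs)
unique-∷ x∉xs ! = All.tabulate (λ y∈xs x≡y → x∉xs (subst (_∈ _) (sym x≡y) y∈xs)) ∷ !

∈-extract : ∀ {A : Set} {x : A} {xs} → x ∈ xs → ∃ λ ys → xs ↭ x ∷ ys
∈-extract x∈xs with ys , zs , refl ← ∈-∃++ x∈xs = ys ++ zs , shift _ ys zs

unique-⊆⇒length≤ : ∀ {A : Set} {xs ys : List A} → Unique xs → xs ⊆ ys → length xs ≤ length ys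
unique-⊆⇒length≤ {xs = []}     _ _ = z≤n
unique-⊆⇒length≤ {xs = x ∷ xs} {ys} (x≢xs ∷ !) xs⊆ys
  with zs , p ← ∈-extract (xs⊆ys (here refl)) =
  ℕ.≤-trans (s≤s (unique-⊆⇒length≤ ! xs⊆zs)) (ℕ.≤-reflexive (sym (↭-length p)))
  where
  xs⊆zs : xs ⊆ zs
  xs⊆zs y∈xs with ∈-resp-↭ p (xs⊆ys (there y∈xs))
  ... | here y≡x   = contradiction (sym y≡x) (All.lookup x≢xs y∈xs)
  ... | there y∈zs = y∈zs

module Hall {A B : Set} (_≟_ : DecidableEquality B) (N : A → List B) where

  open DecMembership _≟_ using (_∈?_)

  lefts : List (A × B) → List A
  lefts = map proj₁

  rights : List (A × B) → List B
  rights = map proj₂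

  Matching : List (A × B) → Set
  Matching = All (λ (a , b) → b ∈ N a)

  -- `Y` holds the right ends that are out of bounds for the new matching.
  Extends : A → List (A × B) → List B → Set
  Extends x M Y = ∃ λ M′ → Matching M′ × lefts M′ ↭ x ∷ lefts M × Unique (Y ++ rights M′)

  -- The set formed by x and the left ends of Z violates Hall's condition outside Y.
  Blocked : A → List (A × B) → List B → Set
  Blocked x M Y = ∃₂ λ Z W → M ↭ Z ++ W × (∀ {a} → a ∈ x ∷ lefts Z → N a ⊆ Y ++ rights Z)

  rights-↭ : ∀ Y {M M′} → M ↭ M′ → Y ++ rights M ↭ Y ++ rights M′
  rights-↭ Y p = ++⁺ˡ Y (map⁺ proj₂ p)

  rights-++ : ∀ Y Z W → (Y ++ rights Z) ++ rights W ≡ Y ++ rights (Z ++ W)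
  rights-++ Y Z W = trans (List.++-assoc Y (rights Z) (rights W)) (cong (Y ++_) (sym (List.map-++ proj₂ Z W)))

  -- Try to match x outside Y. If a wanted y is matched to a, first try to match a anew
  -- without y; failing that, what blocks a can be added to Y before trying x again.
  augment : ∀ n M → length M ≤ n → ∀ x Y → Matching M → Unique (Y ++ rights M) →
            Extends x M Y ⊎ Blocked x M Y
  reroute : ∀ n M → length M ≤ n → ∀ x Y → Matching M → Unique (Y ++ rights M) →
            ∀ {y} → y ∈ N x → y ∈ rights M → Extends x M Y ⊎ Blocked x M Y

  augment n M M≤n x Y m ! with all? (_∈? Y) (N x)
  ... | yes Nx⊆Y =
    inj₂ ([] , M , ↭-refl , λ { (here refl) b∈ → ∈-++⁺ˡ (All.lookup Nx⊆Y b∈) })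
  ... | no Nx⊈Y with y , y∈Nx , y∉Y ← find (All.¬All⇒Any¬ (_∈? Y) (N x) Nx⊈Y) with y ∈? rights M
  ...   | yes y∈M = reroute n M M≤n x Y m ! y∈Nx y∈M
  ...   | no y∉M =
    inj₁ ( (x , y) ∷ M , y∈Nx ∷ m , ↭-refl
         , unique-resp-↭ (↭-sym (shift y Y (rights M))) (unique-∷ y∉ !))
    where
    y∉ : y ∉ Y ++ rights M
    y∉ y∈ with ∈-++⁻ Y y∈
    ... | inj₁ y∈Y = y∉Y y∈Y
    ... | inj₂ y∈M = y∉M y∈M
  reroute zero [] M≤n x Y m ! y∈Nx ()
  reroute (suc n) M M≤n x Y m ! {y} y∈Nx y∈M
    with (a , .y) , ay∈M , refl ← ∈-map⁻ proj₂ y∈M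
    with M₁ , M↭ ← ∈-extract ay∈M
    with y∈Na ∷ m₁ ← All-resp-↭ M↭ m
    -- The bound `n` ensures termination: both `M₁` and its part `W` lack the pair `(a , y)`.
    with s≤s M₁≤n ← subst (_≤ suc n) (↭-length M↭) M≤n
    with augment n M₁ M₁≤n a (y ∷ Y) m₁ (unique-resp-↭ (shift y Y _) (unique-resp-↭ (rights-↭ Y M↭) !))
  ... | inj₁ (M′ , m′ , l , !′) =
    inj₁ ( (x , y) ∷ M′ , y∈Nx ∷ m′ , prep x (↭-trans l (map⁺ proj₁ (↭-sym M↭)))
         , unique-resp-↭ (↭-sym (shift y Y _)) !′)
  ... | inj₂ (Z , W , M₁↭ , closed)
    with M↭′ ← ↭-trans M↭ (prep (a , y) M₁↭)
    with mZ , mW ← All.++⁻ ((a , y) ∷ Z) (All-resp-↭ M↭′ m)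
    with augment n W (ℕ.≤-trans (subst (length W ≤_) (sym (↭-length M₁↭)) (List.length-++-≤ʳ W {Z})) M₁≤n)
           x (Y ++ y ∷ rights Z) mW
           (subst Unique (sym (rights-++ Y ((a , y) ∷ Z) W)) (unique-resp-↭ (rights-↭ Y M↭′) !))
  ...   | inj₁ (M′ , m′ , l , !′) =
    inj₁ ( (a , y) ∷ Z ++ M′ , All.++⁺ mZ m′ , lefts↭
         , subst Unique (rights-++ Y ((a , y) ∷ Z) M′) !′)
    where
    lefts↭ : lefts (((a , y) ∷ Z) ++ M′) ↭ x ∷ lefts M
    lefts↭ = ↭-trans (↭-reflexive (List.map-++ proj₁ ((a , y) ∷ Z) M′))
            (↭-trans (++⁺ˡ (a ∷ lefts Z) l)
            (↭-trans (shift x (a ∷ lefts Z) (lefts W))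
            (prep x (↭-trans (↭-reflexive (sym (List.map-++ proj₁ ((a , y) ∷ Z) W)))
                             (map⁺ proj₁ (↭-sym M↭′))))))
  ...   | inj₂ (Z′ , W′ , W↭ , closed′) =
    inj₂ ( (a , y) ∷ Z ++ Z′ , W′
         , ↭-trans M↭′ (↭-trans (++⁺ˡ ((a , y) ∷ Z) W↭)
                                (↭-reflexive (sym (List.++-assoc ((a , y) ∷ Z) Z′ W′))))
         , covered)
    where
    late : ∀ {b} → b ∈ (Y ++ y ∷ rights Z) ++ rights Z′ → b ∈ Y ++ rights ((a , y) ∷ Z ++ Z′)
    late {b} = subst (b ∈_) (rights-++ Y ((a , y) ∷ Z) Z′)

    early : ∀ {b} → b ∈ (y ∷ Y) ++ rights Z → b ∈ Y ++ rights ((a , y) ∷ Z ++ Z′)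
    early b∈ = late (∈-++⁺ˡ (∈-resp-↭ (↭-sym (shift y Y (rights Z))) b∈))

    covered : ∀ {c} → c ∈ x ∷ lefts ((a , y) ∷ Z ++ Z′) → N c ⊆ Y ++ rights ((a , y) ∷ Z ++ Z′)
    covered (here refl)         b∈ = late (closed′ (here refl) b∈)
    covered (there (here refl)) b∈ = early (closed (here refl) b∈)
    covered (there (there c∈))  b∈ with ∈-++⁻ (lefts Z) (subst (_ ∈_) (List.map-++ proj₁ Z Z′) c∈)
    ... | inj₁ c∈Z  = early (closed (there c∈Z) b∈)
    ... | inj₂ c∈Z′ = late (closed′ (there c∈Z′) b∈)

  -- Quantifying over all lists `Y` that cover the neighbourhoods of `X` avoids forming their union.
  -- Vertices are matched one at a time with nothing out of bounds; a blocked `x` would give one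
  -- more left end than right ends covering all their neighbours.
  hall : ∀ L → Unique L →
         (∀ X Y → Unique X → X ⊆ L → (∀ {a} → a ∈ X → N a ⊆ Y) → length X ≤ length Y) →
         ∃ λ M → Matching M × lefts M ↭ L × Unique (rights M)
  hall [] _ _ = [] , [] , ↭-refl , []
  hall (x ∷ L) !xL@(_ ∷ !L) condition
    with M , m , l , ! ← hall L !L (λ X Y !X X⊆L → condition X Y !X (there ∘ X⊆L))
    with augment (length M) M ℕ.≤-refl x [] m !
  ... | inj₁ (M′ , m′ , l′ , !′) = M′ , m′ , ↭-trans l′ (prep x l) , !′
  ... | inj₂ (Z , W , M↭ , closed) = contradiction
    (condition (x ∷ lefts Z) (rights Z) unique (∈-resp-↭ xL↭ ∘ ∈-++⁺ˡ) closed)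
    (ℕ.<⇒≱ (s≤s (ℕ.≤-reflexive (trans (List.length-map proj₂ Z) (sym (List.length-map proj₁ Z))))))
    where
    xL↭ : x ∷ lefts Z ++ lefts W ↭ x ∷ L
    xL↭ = prep x (↭-trans (↭-reflexive (sym (List.map-++ proj₁ Z W)))
                          (↭-trans (map⁺ proj₁ (↭-sym M↭)) l))
    unique : Unique (x ∷ lefts Z)
    unique = proj₁ (++-unique⁻ (x ∷ lefts Z) (unique-resp-↭ (↭-sym xL↭) !xL))
      where
      ++-unique⁻ : ∀ xs {ys} → Unique (xs ++ ys) → Unique xs × Unique ys
      ++-unique⁻ [] ! = [] , !
      ++-unique⁻ (x ∷ xs) (x≢ ∷ !) = let !xs , !ys = ++-unique⁻ xs ! in All.++⁻ˡ xs x≢ ∷ !xs , !ys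

unique-map-injective : ∀ {A B : Set} {f : A → B} {xs x y} → Unique (map f xs) →
                       x ∈ xs → y ∈ xs → f x ≡ f y → x ≡ y
unique-map-injective _ (here refl) (here refl) _ = refl
unique-map-injective {f =
  f} (fx≢ ∷ _) (here refl) (there y∈) eq = contradiction eq (All.lookup fx≢ (∈-map⁺ f y∈))
unique-map-injective {f =
  f} (fy≢ ∷ _) (there x∈) (here refl) eq = contradiction (sym eq) (All.lookup fy≢ (∈-map⁺ f x∈))
unique-map-injective (_ ∷ !) (there x∈) (there y∈) eq = unique-map-injective ! x∈ y∈ eq

-- Double counting in a bipartite graph

module _ {A B : Set} (f : A → List B) (d : ℕ) where

  length-concatMap-≥ : ∀ xs → (∀ {x} → x ∈ xs → d ≤ length (f x)) → length xs * d ≤ length (concatMap f xs)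
  length-concatMap-≥ []       _ = z≤n
  length-concatMap-≥ (x ∷ xs) h = subst (_ ≤_) (sym (List.length-++ (f x)))
    (ℕ.+-mono-≤ (h (here refl)) (length-concatMap-≥ xs (h ∘ there)))

  length-concatMap-≤ : ∀ xs → (∀ {x} → x ∈ xs → length (f x) ≤ d) → length (concatMap f xs) ≤ length xs * d
  length-concatMap-≤ []       _ = z≤n
  length-concatMap-≤ (x ∷ xs) h = subst (_≤ _) (sym (List.length-++ (f x)))
    (ℕ.+-mono-≤ (h (here refl)) (length-concatMap-≤ xs (h ∘ there)))

-- Double counting of the edges (a , j), recorded on the other side as (a · j , j).
module _ {A B J : Set} (_·_ : A → J → B) (out : A → List J) (in′ : B → List J)
         (out-unique : ∀ a → Unique (out a))
         (out⇒in : ∀ {a j} → j ∈ out a → j ∈ in′ (a · j))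
         (·-injective : ∀ {a a′ j} → j ∈ out a → j ∈ out a′ → a · j ≡ a′ · j → a ≡ a′) where

  outgoing : A → List (B × J)
  outgoing a = map (λ j → a · j , j) (out a)

  incoming : B → List (B × J)
  incoming b = map (b ,_) (in′ b)

  outgoing-injective : ∀ {a a′ e} → e ∈ outgoing a → e ∈ outgoing a′ → a ≡ a′
  outgoing-injective e∈ e∈′ with j , j∈ , refl ← ∈-map⁻ _ e∈ with j , j∈′ , eq ← ∈-map⁻ _ e∈′
    with refl ← cong proj₂ eq = ·-injective j∈ j∈′ (cong proj₁ eq)

  outgoing-unique : ∀ {X} → Unique X → Unique (concatMap outgoing X)
  outgoing-unique [] = []
  outgoing-unique {X = a ∷ X} (a≢ ∷ !) =
    Unique.++⁺ (Unique.map⁺ (cong proj₂) (out-unique a)) (outgoing-unique !) λ (e∈a , e∈X) →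
      let a′ , a′∈X , e∈a′ = find (∈-concatMap⁻ outgoing {xs = X} e∈X)
      in All.lookup a≢ a′∈X (outgoing-injective e∈a e∈a′)

  -- The number of edges leaving `X` is at least `length X * suc d` and at most `length Y * suc d`.
  -- Writing the degree as `suc d` makes it cancellable.
  degrees⇒length≤ : ∀ d X Y → (∀ {a} → a ∈ X → suc d ≤ length (out a)) →
                    (∀ {b} → b ∈ Y → length (in′ b) ≤ suc d) →
                    Unique X → (∀ {a j} → a ∈ X → j ∈ out a → a · j ∈ Y) → length X ≤ length Y
  degrees⇒length≤ d X Y out≥ in≤ ! closed = ℕ.*-cancelʳ-≤ (length X) (length Y) (suc d) (begin
    length X * suc d
      ≤⟨ length-concatMap-≥ outgoing (suc d) X
           (λ a∈ → subst (_ ≤_) (sym (List.length-map _ (out _))) (out≥ a∈)) ⟩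
    length (concatMap outgoing X)
      ≤⟨ unique-⊆⇒length≤ (outgoing-unique !) edges⊆ ⟩
    length (concatMap incoming Y)
      ≤⟨ length-concatMap-≤ incoming (suc d) Y
           (λ b∈ → subst (_≤ _) (sym (List.length-map _ (in′ _))) (in≤ b∈)) ⟩
    length Y * suc d
      ∎)
    where
    open ℕ.≤-Reasoning
    edges⊆ : concatMap outgoing X ⊆ concatMap incoming Y
    edges⊆ e∈ with a , a∈ , e∈a ← find (∈-concatMap⁻ outgoing {xs = X} e∈)
      with j , j∈ , refl ← ∈-map⁻ _ e∈a =
      ∈-concatMap⁺ incoming (lose (closed a∈ j∈) (∈-map⁺ _ (out⇒in j∈)))

-- Subsets of [r] as lists, and the list of all subsets

members : Subset r → List (Fin r)
members []            = []
members (inside ∷ p)  = zero ∷ map suc (members p)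
members (outside ∷ p) = map suc (members p)

length-members : (p : Subset r) → length (members p) ≡ ∣ p ∣
length-members []            = refl
length-members (inside ∷ p)  = cong suc (trans (List.length-map suc (members p)) (length-members p))
length-members (outside ∷ p) = trans (List.length-map suc (members p)) (length-members p)

∈-members⁺ : (p : Subset r) (j : Fin r) → lookup p j ≡ inside → j ∈ members p
∈-members⁺ (inside ∷ p)  zero    _ = here refl
∈-members⁺ (inside ∷ p)  (suc j) e = there (∈-map⁺ suc (∈-members⁺ p j e))
∈-members⁺ (outside ∷ p) (suc j) e = ∈-map⁺ suc (∈-members⁺ p j e)

∈-members⁻ : (p : Subset r) {j : Fin r} → j ∈ members p → lookup p j ≡ inside
∈-members⁻ (inside ∷ p)  (here refl) = refl
∈-members⁻ (inside ∷ p)  (there j∈) with _ , k∈ , refl ← ∈-map⁻ suc j∈ = ∈-members⁻ p k∈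
∈-members⁻ (outside ∷ p) j∈ with _ , k∈ , refl ← ∈-map⁻ suc j∈ = ∈-members⁻ p k∈

members-unique : (p : Subset r) → Unique (members p)
members-unique []            = []
members-unique (inside ∷ p)  =
  unique-∷ zero∉ (Unique.map⁺ Fin.suc-injective (members-unique p))
  where
  zero∉ : zero ∉ map suc (members p)
  zero∉ 0∈ with () ← proj₂ (proj₂ (∈-map⁻ suc 0∈))
members-unique (outside ∷ p) = Unique.map⁺ Fin.suc-injective (members-unique p)

subsets : ∀ r → List (Subset r)
subsets zero    = [] ∷ []
subsets (suc r) = map (inside ∷_) (subsets r) ++ map (outside ∷_) (subsets r)

∈-subsets : (p : Subset r) → p ∈ subsets r
∈-subsets []                     = here refl
∈-subsets (inside ∷ p)           = ∈-++⁺ˡ (∈-map⁺ _ (∈-subsets p))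
∈-subsets {suc r} (outside ∷ p)  = ∈-++⁺ʳ (map (inside ∷_) (subsets r)) (∈-map⁺ _ (∈-subsets p))

subsets-unique : ∀ r → Unique (subsets r)
subsets-unique zero    = All.[] ∷ []
subsets-unique (suc r) =
  Unique.++⁺ (Unique.map⁺ Vec.∷-injectiveʳ (subsets-unique r)) (Unique.map⁺ Vec.∷-injectiveʳ (subsets-unique r))
    disjoint
  where
  disjoint : Disjoint (map (inside ∷_) (subsets r)) (map (outside ∷_) (subsets r))
  disjoint (p∈ , p∈′) with _ , _ , refl ← ∈-map⁻ _ p∈ with () ← proj₂ (proj₂ (∈-map⁻ _ p∈′))

∣insert∣ : (T : Subset r) (j : Fin r) → lookup T j ≡ outside → ∣ T [ j ]≔ inside ∣ ≡ suc ∣ T ∣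
∣insert∣ (outside ∷ T) zero    _ = refl
∣insert∣ (inside ∷ T)  (suc j) e = cong suc (∣insert∣ T j e)
∣insert∣ (outside ∷ T) (suc j) e = ∣insert∣ T j e

delete-insert : (T : Subset r) (j : Fin r) → lookup T j ≡ outside →
                (T [ j ]≔ inside) [ j ]≔ outside ≡ T
delete-insert T j e =
  trans (Vec.[]≔-idempotent T j) (trans (cong (T [ j ]≔_) (sym e)) (Vec.[]≔-lookup T j))

-- Matching k-sets with (k+1)-sets

additions : Subset r → List (Fin r)
additions T = members (slots afterUp T)

additions-step : (T : Subset r) {j : Fin r} → j ∈ additions T →
                 lookup T j ≡ outside × Step outside T (T [ j ]≔ inside)
additions-step T {j} j∈ = slots-step afterUp T j (∈-members⁻ (slots afterUp T) j∈)

-- With m additions, 7(k+1) ≤ 2r + 5 ≤ 2m + 5k + 6 leaves 2(k+1) ≤ 2m + 1, that is 2(k+1) < 2(m+1),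
-- and integrality gives k + 1 ≤ m.
enough-additions : ∀ k (T : Subset r) → ∣ T ∣ ≡ k → 7 * suc k ≤ 2 * r + 5 → suc k ≤ length (additions T)
enough-additions {r} k T refl small = subst (suc k ≤_) (sym (length-members (slots afterUp T)))
  (s≤s⁻¹ (ℕ.*-cancelˡ-< 2 (suc k) (suc m) (ℕ.+-cancelʳ-≤ (5 * k + 5) _ _ (begin
    suc (2 * suc k) + (5 * k + 5)
      ≡⟨ solve 1 (λ k → con 1 :+ con 2 :* (con 1 :+ k) :+ (con 5 :* k :+ con 5)
                     := con 1 :+ con 7 :* (con 1 :+ k)) refl k ⟩
    suc (7 * suc k)
      ≤⟨ s≤s small ⟩
    suc (2 * r + 5)
      ≤⟨ s≤s (ℕ.+-monoˡ-≤ 5 (slots-bound afterUp T)) ⟩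
    suc (2 * m + (5 * k + 1) + 5)
      ≡⟨ solve 2 (λ m k → con 1 :+ (con 2 :* m :+ (con 5 :* k :+ con 1) :+ con 5)
                       := con 2 :* (con 1 :+ m) :+ (con 5 :* k :+ con 5)) refl m k ⟩
    2 * suc m + (5 * k + 5)
      ∎))))
  where
  open ℕ.≤-Reasoning
  open +-*-Solver
  m = ∣ slots afterUp T ∣

neighbours : Subset r → List (Subset r)
neighbours T = map (T [_]≔ inside) (additions T)

ksubsets : ∀ r → ℕ → List (Subset r)
ksubsets r k = filter (λ T → ∣ T ∣ ℕ.≟ k) (subsets r)

-- Each k-set has at least k + 1 additions, while a (k+1)-set arises by adding one of its k + 1
-- members.
hall-condition : ∀ {k} → 7 * suc k ≤ 2 * r + 5 → ∀ X Y → Unique X → X ⊆ ksubsets r k →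
                 (∀ {T} → T ∈ X → neighbours T ⊆ Y) → length X ≤ length Y
hall-condition {r} {k} small X Y ! X⊆ closed = ℕ.≤-trans
  (degrees⇒length≤ (λ T j → T [ j ]≔ inside) additions members
    (λ T → members-unique (slots afterUp T))
    (λ {T} {j} _ → ∈-members⁺ (T [ j ]≔ inside) j (Vec.lookup∘updateAt j T))
    -- Since `j` lies in neither set, deleting it from the common image recovers both.
    (λ {T} {T′} {j} j∈ j∈′ eq →
      trans (sym (delete-insert T j (proj₁ (additions-step T j∈))))
            (trans (cong (_[ j ]≔ outside) eq) (delete-insert T′ j (proj₁ (additions-step T′ j∈′)))))
    k X Y′
    (λ {T} T∈ → enough-additions k T (size T∈) small)
    (λ {S} S∈ → ℕ.≤-reflexive (trans (length-members S) (proj₂ (∈-filter⁻ big? {xs = Y} S∈))))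
    !
    (λ {T} {j} T∈ j∈ → ∈-filter⁺ big? (closed T∈ (∈-map⁺ _ j∈))
      (trans (∣insert∣ T j (proj₁ (additions-step T j∈))) (cong suc (size T∈)))))
  (List.length-filter big? Y)
  where
  big? = λ (S : Subset r) → ∣ S ∣ ℕ.≟ suc k
  -- `Y` may contain sets of other sizes, to which the in-degree bound does not apply; the
  -- neighbours of `X` survive the filter.
  Y′ = filter big? Y
  size : ∀ {T} → T ∈ X → ∣ T ∣ ≡ k
  size T∈ = proj₂ (∈-filter⁻ (λ T → ∣ T ∣ ℕ.≟ k) {xs = subsets r} (X⊆ T∈))

theorem6p2 : ∀ (r i : ℕ) → 0 < i → 7 * i ≤ 2 * r + 5 →
    Σ (KSubset r (i ∸ 1) → KSubset r i) λ φ →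
    (∀ T T' → proj₁ (φ T) ≡ proj₁ (φ T') → proj₁ T ≡ proj₁ T')
    × (∀ T → Dominates (proj₁ (φ T)) (proj₁ T))
theorem6p2 r (suc k) _ small
  with M , matched , l , ! ← Hall.hall (Vec.≡-dec _≟ᵇ_) neighbours (ksubsets r k)
                               (Unique.filter⁺ _ (subsets-unique r)) (hall-condition small)
  = φ , φ-injective , λ T → step⇒dominates (proj₂ (φ-data T))
  where
  -- The left ends of `M` are a rearrangement of all k-sets, so every `T` is matched.
  partner : (T : KSubset r k) → ∃ λ S → (proj₁ T , S) ∈ M
  partner (T , eq)
    with (T , S) , TS∈M , refl ← ∈-map⁻ proj₁ (∈-resp-↭ (↭-sym l) (∈-filter⁺ _ (∈-subsets T) eq))
    = S , TS∈M

  φ-data : (T : KSubset r k) → let S , _ = partner T in ∣ S ∣ ≡ suc k × Step outside (proj₁ T) S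
  φ-data T with S , TS∈M ← partner T
    with j , j∈ , refl ← ∈-map⁻ (proj₁ T [_]≔ inside) (All.lookup matched TS∈M)
    with outside-T , step ← additions-step (proj₁ T) j∈
    = trans (∣insert∣ (proj₁ T) j outside-T) (cong suc (proj₂ T)) , step

  φ : KSubset r k → KSubset r (suc k)
  φ T = proj₁ (partner T) , proj₁ (φ-data T)

  φ-injective : ∀ T T′ → proj₁ (φ T) ≡ proj₁ (φ T′) → proj₁ T ≡ proj₁ T′
  φ-injective T T′ eq =
    -- The right ends in `M` are distinct, so a pair of `M` is determined by its right end.
    cong proj₁ (unique-map-injective ! (proj₂ (partner T)) (proj₂ (partner T′)) eq)
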